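{- Let $m\ge 2$ and $n\ge 2m-1$ be integers. Then $$\gamma_{Zg}(K_m\,\square\,K_n)=\gamma_{Lg}(K_m\,\square\,K_n)=\gamma_{LLg}(K_m\,\square\,K_n)=2m-1,$$ where $K_m\,\square\,K_n$ is the Cartesian product of the complete graphs on $m$ and $n$ vertices.
   Context: $N(v)$ and $N[v]=N(v)\cup\{v\}$ denote the open and closed neighborhood of a vertex $v$. The Cartesian product $G\,\square\,H$ has vertex set $V(G)\times V(H)$; vertices $(g,h)$ and $(g',h')$ are adjacent if either $gg'\in E(G)$ and $h=h'$, or $g=g'$ and $hh'\in E(H)$. Games: two players, Dominator and Staller, alternately select vertices $v_1,v_2,\ldots$ of an isolate-free graph $G$. The $i$-th move $v_i$ is legal: - in the Z-domination game, if $N(v_i)\setminus\bigcup_{j=1}^{i-1}N[v_j]\neq\emptyset$; - in the L-domination game, if $N[v_i]\setminus\bigcup_{j=1}^{i-1}N(v_j)\neq\emptyset$ and $v_i\neq v_j$ for all $j<i$; - in the LL-domination game, if $N[v_i]\setminus\bigcup_{j=1}^{i-1}N(v_j)\neq\emptyset$. Each game ends when no legal move is available. Dominator wants to minimize the total number of moves, Staller wants to maximize it. When Dominator moves first and both players play optimally, the total number of moves played (by both players) is $\gamma_{Zg}(G)$, $\gamma_{Lg}(G)$, $\gamma_{LLg}(G)$ in the Z-, L-, and LL-domination game, respectively. -}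

module Defs where

open import Data.Empty using (⊥-elim)
open import Data.Fin using (Fin; zero; suc)
open import Data.Fin.Properties using (*↔×)
open import Data.List using (List; []; _∷_)
open import Data.List.Membership.Propositional using () renaming (_∉_ to _∉ᴸ_)
open import Data.List.Relation.Unary.Any using (Any)
open import Data.Nat using (ℕ; zero; suc; _*_; _≤_; z≤n; s≤s)
open import Data.Nat.Properties using (≤-antisym)
open import Data.Product using (_×_; _,_; ∃; ∃-syntax)
open import Data.Product.Function.NonDependent.Propositional using (_×-↔_)
open import Data.Sum using (_⊎_; inj₁; inj₂)
open import Data.Unit using (⊤)
open import Function.Bundles using (_↔_)
open import Function.Construct.Composition using (_↔-∘_)
open import Function.Construct.Identity using (↔-id)
open import Function.Construct.Symmetry using (↔-sym)
open import Level using (0ℓ)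
open import Relation.Binary.PropositionalEquality using (_≡_; _≢_; refl; sym; ≢-sym)
open import Relation.Nullary using (¬_)
open import Relation.Unary using (Pred; Satisfiable; _∖_; _∪_; ｛_｝)

record Graph : Set₁ where
  field
    V       : Set
    order   : ℕ
    finite  : V ↔ Fin order
    Adj     : V → V → Set
    Adj-sym : ∀ {u v} → Adj u v → Adj v u
    irrefl  : ∀ {v} → ¬ Adj v v

  N : V → Pred V 0ℓ
  N v = Adj v

  N[_] : V → Pred V 0ℓ
  N[ v ] = N v ∪ ｛ v ｝

IsolateFree : Graph → Set
IsolateFree G = ∀ v → Satisfiable (N v)
  where open Graph G

K : ℕ → Graph
K n = record
  { V       = Fin n
  ; order   = n
  ; finite  = ↔-id (Fin n)
  ; Adj     = _≢_
  ; Adj-sym = ≢-sym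
  ; irrefl  = λ v≢v → v≢v refl
  }

infixr 6 _□_

_□_ : Graph → Graph → Graph
G □ H = record
  { V       = G.V × H.V
  ; order   = G.order * H.order
  ; finite  = ↔-sym *↔× ↔-∘ (G.finite ×-↔ H.finite)
  ; Adj     = λ (g , h) (g′ , h′) → (G.Adj g g′ × h ≡ h′) ⊎ (g ≡ g′ × H.Adj h h′)
  ; Adj-sym = λ { (inj₁ (a , e)) → inj₁ (G.Adj-sym a , sym e)
                ; (inj₂ (e , a)) → inj₂ (sym e , H.Adj-sym a) }
  ; irrefl  = λ { (inj₁ (a , _)) → G.irrefl a
                ; (inj₂ (_ , a)) → H.irrefl a }
  }
  where
  module G = Graph G
  module H = Graph H

K□K-isolateFree : ∀ m n → 2 ≤ m → IsolateFree (K m □ K n)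
K□K-isolateFree (suc (suc m)) n (s≤s (s≤s _)) (zero  , h) = (suc zero , h) , inj₁ ((λ ()) , refl)
K□K-isolateFree (suc (suc m)) n (s≤s (s≤s _)) (suc g , h) = (zero     , h) , inj₁ ((λ ()) , refl)

data Game : Set where
  Z L LL : Game

data Player : Set where
  Dominator Staller : Player

module _ (G : Graph) where
  open Graph G

  ⋃ⱼ : (V → Pred V 0ℓ) → List V → Pred V 0ℓ
  ⋃ⱼ P h x = Any (λ u → P u x) h

  Legal : Game → List V → V → Set
  Legal Z  h v = Satisfiable (N v ∖ ⋃ⱼ N[_] h)
  Legal L  h v = Satisfiable (N[ v ] ∖ ⋃ⱼ N h) × v ∉ᴸ h
  Legal LL h v = Satisfiable (N[ v ] ∖ ⋃ⱼ N h)

  module _ (game : Game) where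

    Over : List V → Set
    Over h = ∀ v → ¬ Legal game h v

    -- The player p is to move after the moves h (latest first).  Dominator
    -- can force the game to end after at most k further moves.
    EndsWithin : Player → ℕ → List V → Set
    EndsWithin p         zero    h = Over h
    EndsWithin Dominator (suc k) h =
      Over h ⊎ (∃[ v ] (Legal game h v × EndsWithin Staller k (v ∷ h)))
    EndsWithin Staller   (suc k) h =
      ∀ v → Legal game h v → EndsWithin Dominator k (v ∷ h)

    -- Staller can force at least k further moves.  When Dominator is to move,
    -- a legal move must exist, since otherwise the game is over.
    LastsAtLeast : Player → ℕ → List V → Set
    LastsAtLeast p         zero    h = ⊤
    LastsAtLeast Dominator (suc k) h =
      ∃ (Legal game h) × (∀ v → Legal game h v → LastsAtLeast Staller k (v ∷ h))
    LastsAtLeast Staller   (suc k) h =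
      ∃[ v ] (Legal game h v × LastsAtLeast Dominator k (v ∷ h))

    lasts≤ends : ∀ p j k h → LastsAtLeast p j h → EndsWithin p k h → j ≤ k
    lasts≤ends p         zero    k       h l e = z≤n
    lasts≤ends Dominator (suc j) zero    h ((v , lv) , _) e = ⊥-elim (e v lv)
    lasts≤ends Staller   (suc j) zero    h (v , lv , _)   e = ⊥-elim (e v lv)
    lasts≤ends Dominator (suc j) (suc k) h ((v , lv) , _) (inj₁ over) = ⊥-elim (over v lv)
    lasts≤ends Dominator (suc j) (suc k) h (_ , f) (inj₂ (v , lv , e)) =
      s≤s (lasts≤ends Staller j k (v ∷ h) (f v lv) e)
    lasts≤ends Staller   (suc j) (suc k) h (v , lv , l) e =
      s≤s (lasts≤ends Dominator j k (v ∷ h) l (e v lv))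

-- γ[ game ] G ≐ k: with Dominator moving first and optimal play by both, the
-- game on G lasts exactly k moves.  This is a relation, given by what each
-- player can guarantee, rather than a function, because in the LL-game an
-- undominated vertex may be replayed, so that the game tree has infinite plays.
infix 4 γ[_]_≐_

γ[_]_≐_ : Game → Graph → ℕ → Set
γ[ game ] G ≐ k = EndsWithin G game Dominator k [] × LastsAtLeast G game Dominator k []

γ-unique : ∀ game G {j k} → γ[ game ] G ≐ j → γ[ game ] G ≐ k → j ≡ k
γ-unique game G {j} {k} (e , l) (e′ , l′) =
  ≤-antisym (lasts≤ends G game Dominator j k [] l e′)
            (lasts≤ends G game Dominator k j [] l′ e)

{-# OPTIONS --safe #-}

-- Call x undominated when no move so far covers it.  In each of the three games
-- the game is over as soon as no vertex is undominated, and every neighbour of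
-- an undominated vertex is an unplayed legal move.
--
-- Upper bound: a column is a total dominating set with m vertices.  As long as
-- some x is undominated, Dominator plays a neighbour of x in that column, and he
-- exhausts the column with his m-th move.
--
-- Lower bound: a vertex whose row and column are both unused is undominated.
-- Staller always plays in the row of Dominator's last move and in an unused
-- column, so only Dominator's moves use new rows, and each move uses at most one
-- new column; hence an undominated vertex remains after 2m - 2 moves.
module Submission where

open import Defs
open import Data.Fin using (Fin; zero)
open import Data.Fin.Properties using (any?; ¬∀⟶∃¬; pigeonhole; <⇒≢; inj⇒≟) renaming (_≟_ to _≟ᶠ_)
open import Data.List using (List; []; _∷_; length; lookup; map; filter; allFin)
open import Data.List.Membership.Propositional using (_∈_; _∉_; find; lose)
open import Data.List.Membership.Propositional.Properties using (∈-filter⁺; ∈-map⁺; ∈-allFin)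
open import Data.List.Properties using (filter-notAll; length-map; length-tabulate)
open import Data.List.Relation.Unary.All as All using (All; []; _∷_)
open import Data.List.Relation.Unary.Any as Any using (here; there; index)
open import Data.List.Relation.Unary.Any.Properties using (lookup-index)
open import Data.Nat using (ℕ; zero; suc; _+_; _≤_; _<_; _*_; _∸_; s≤s)
open import Data.Nat.Properties
  using (≤-refl; ≤-trans; ≤-pred; ≤-reflexive; *-comm; +-suc; <-≤-trans; m<m+n; 0<1+n)
open import Data.Product using (_×_; _,_; proj₁; proj₂; ∃; ∃-syntax)
open import Data.Sum using (_⊎_; inj₁; inj₂)
open import Data.Unit using (tt)
open import Function using (_∘_; id)
open import Function.Bundles using (Inverse)
open import Function.Properties.Inverse using (Inverse⇒Injection)
open import Level using (0ℓ)
open import Relation.Binary.Definitions using (Decidable; DecidableEquality)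
open import Relation.Binary.PropositionalEquality using (_≡_; refl; sym; trans; cong; subst)
open import Relation.Nullary using (¬_; Dec; yes; no; contradiction)
open import Relation.Nullary.Decidable using (¬?; _×-dec_; _⊎-dec_)
open import Relation.Unary as U using (Pred; ∁)

-- If every `i` occurred in `xs`, the pigeonhole principle would give two distinct elements the same
-- position.
fresh : ∀ {n} (xs : List (Fin n)) → length xs < n → ∃[ i ] i ∉ xs
fresh {n} xs short = ¬∀⟶∃¬ n (_∈ xs) (λ i → Any.any? (i ≟ᶠ_) xs) notAll
  where
  notAll : ¬ (∀ i → i ∈ xs)
  notAll all with pigeonhole short (index ∘ all)
  ... | i , j , i<j , eq = <⇒≢ i<j
    (trans (lookup-index (all i)) (trans (cong (lookup xs) eq) (sym (lookup-index (all j)))))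

module _ (G : Graph) where
  open Graph G

  _≟ⱽ_ : DecidableEquality V
  _≟ⱽ_ = inj⇒≟ (Inverse⇒Injection finite)

  search : ∀ {P : Pred V 0ℓ} → U.Decidable P → Dec (∃ P)
  search {P} P? with any? (P? ∘ Inverse.from finite)
  ... | yes (i , p) = yes (Inverse.from finite i , p)
  ... | no ¬p = no λ (x , p) →
    ¬p (Inverse.to finite x , subst P (sym (Inverse.strictlyInverseʳ finite x)) p)

  -- The neighbourhood that an earlier move subtracts in `Legal`; hence any witness of legality is
  -- an undominated vertex.
  Covers : Game → V → Pred V 0ℓ
  Covers Z  = N[_]
  Covers L  = N
  Covers LL = N

  Undominated : Game → List V → Pred V 0ℓ
  Undominated game h = ∁ (⋃ⱼ G (Covers game) h)

  adj⇒covers : ∀ game {u x} → Adj u x → Covers game u x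
  adj⇒covers Z  = inj₁
  adj⇒covers L  a = a
  adj⇒covers LL a = a

  covers? : Decidable Adj → ∀ game → Decidable (Covers game)
  covers? adj? Z  u x = adj? u x ⊎-dec (u ≟ⱽ x)
  covers? adj? L  = adj?
  covers? adj? LL = adj?

  neighbour-unplayed : ∀ game {h v x} → Undominated game h x → Adj v x → v ∉ h
  neighbour-unplayed game x∉ a v∈h = x∉ (lose v∈h (adj⇒covers game a))

  neighbour-legal : ∀ game {h v x} → Undominated game h x → Adj v x → Legal G game h v
  neighbour-legal Z  x∉ a = _ , a , x∉
  neighbour-legal L  x∉ a = (_ , inj₁ a , x∉) , neighbour-unplayed L x∉ a
  neighbour-legal LL x∉ a = _ , inj₁ a , x∉

  dominated⇒over : ∀ game {h} → ¬ ∃ (Undominated game h) → Over G game h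
  dominated⇒over Z  none v (x , _ , x∉)       = none (x , x∉)
  dominated⇒over L  none v ((x , _ , x∉) , _) = none (x , x∉)
  dominated⇒over LL none v (x , _ , x∉)       = none (x , x∉)

  TotalDominating : Pred V 0ℓ → Set
  TotalDominating D = ∀ x → ∃[ y ] (D y × Adj y x)

  module _ (adj? : Decidable Adj) (game : Game) {D : Pred V 0ℓ} (total : TotalDominating D) where

    -- Only an upper bound on what is left of `D`: `S` may keep played vertices, so it need not
    -- change when Staller moves.
    UnplayedIn : List V → List V → Set
    UnplayedIn h S = ∀ {y} → D y → y ∈ h ⊎ y ∈ S

    -- Each move of Dominator shortens `S`, so he makes at most `suc k` more moves, with `k` replies
    -- in between. Once `S` is empty, all of `D` is played and every vertex has a played neighbour.
    dominator-ends : ∀ k {h} S → length S ≤ suc k → UnplayedIn h S →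
                     EndsWithin G game Dominator (suc (k * 2)) h
    staller-ends   : ∀ k {h} S → length S ≤ k → UnplayedIn h S →
                     EndsWithin G game Staller (k * 2) h

    dominator-ends k {h} S |S|≤ unplayed
      with search (λ x → ¬? (Any.any? (λ u → covers? adj? game u x) h))
    ... | no none = inj₁ (dominated⇒over game none)
    ... | yes (x , x∉) with total x
    ...   | y , Dy , a with unplayed Dy
    -- A played `y` would already cover `x`; so `y` is in `S`, and filtering it out shortens the
    -- list.
    ...     | inj₁ y∈h = contradiction y∈h (neighbour-unplayed game x∉ a)
    ...     | inj₂ y∈S = inj₂ (y , neighbour-legal game x∉ a ,
                staller-ends k (filter ≢y? S) |S′|≤k unplayed′)
      where
      ≢y? : U.Decidable (λ z → ¬ z ≡ y)
      ≢y? z = ¬? (z ≟ⱽ y)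

      |S′|≤k : length (filter ≢y? S) ≤ k
      |S′|≤k = ≤-pred (≤-trans (filter-notAll ≢y? S (lose y∈S λ y≢y → y≢y refl)) |S|≤)

      unplayed′ : UnplayedIn (y ∷ h) (filter ≢y? S)
      unplayed′ {z} Dz with z ≟ⱽ y | unplayed Dz
      ... | yes z≡y | _        = inj₁ (here z≡y)
      ... | no _    | inj₁ z∈h = inj₁ (there z∈h)
      ... | no z≢y  | inj₂ z∈S = inj₂ (∈-filter⁺ ≢y? z∈S z≢y)

    staller-ends zero {h} [] _ unplayed = dominated⇒over game none
      where
      none : ¬ ∃ (Undominated game h)
      none (x , x∉) with total x
      ... | y , Dy , a with unplayed Dy
      ...   | inj₁ y∈h = neighbour-unplayed game x∉ a y∈h
    staller-ends (suc k) S |S|≤ unplayed v _ = dominator-ends k S |S|≤ λ Dy → later (unplayed Dy)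
      where
      later : ∀ {h y} → y ∈ h ⊎ y ∈ S → y ∈ v ∷ h ⊎ y ∈ S
      later (inj₁ y∈h) = inj₁ (there y∈h)
      later (inj₂ y∈S) = inj₂ y∈S

rook-adj? : ∀ m n → Decidable (Graph.Adj (K m □ K n))
rook-adj? m n (i , j) (i′ , j′) =
  (¬? (i ≟ᶠ i′) ×-dec (j ≟ᶠ j′)) ⊎-dec ((i ≟ᶠ i′) ×-dec ¬? (j ≟ᶠ j′))

InColumn : ∀ {m n} → Fin n → Pred (Fin m × Fin n) 0ℓ
InColumn j u = proj₂ u ≡ j

column-totalDominating : ∀ m {n} → 2 ≤ m → (c : Fin n) → TotalDominating (K m □ K n) (InColumn c)
column-totalDominating m {n} 2≤m c (i , j) with j ≟ᶠ c
... | no j≢c = (i , c) , refl , inj₂ (refl , j≢c ∘ sym)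
-- The factor `K 1` has no edges, so a neighbour in this product must supply a second row.
... | yes refl with K□K-isolateFree m 1 2≤m (i , zero)
...   | (i′ , _) , inj₁ (i≢i′ , _) = (i′ , c) , refl , inj₁ (i≢i′ ∘ sym , refl)
...   | (_ , zero) , inj₂ (_ , 0≢0) = contradiction refl 0≢0

rook-ends : ∀ game k {n} → 2 ≤ suc k → Fin n →
            EndsWithin (K (suc k) □ K n) game Dominator (suc (k * 2)) []
rook-ends game k {n} 2≤m c =
  dominator-ends (K (suc k) □ K n) (rook-adj? (suc k) n) game
    (column-totalDominating (suc k) 2≤m c) k column
    (≤-reflexive (trans (length-map _ (allFin (suc k))) (length-tabulate {n = suc k} id)))
    λ { {i , _} refl → inj₂ (∈-map⁺ (_, c) (∈-allFin i)) }
  where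
  column : List (Fin (suc k) × Fin n)
  column = map (_, c) (allFin (suc k))

module _ (game : Game) {m n : ℕ} (2≤m : 2 ≤ m) where

  G : Graph
  G = K m □ K n

  covers⇒aligned : ∀ game {u x} → Covers G game u x → proj₁ u ≡ proj₁ x ⊎ proj₂ u ≡ proj₂ x
  covers⇒aligned Z  (inj₁ (inj₁ (_ , e))) = inj₂ e
  covers⇒aligned Z  (inj₁ (inj₂ (e , _))) = inj₁ e
  covers⇒aligned Z  (inj₂ refl)           = inj₁ refl
  covers⇒aligned L  (inj₁ (_ , e))        = inj₂ e
  covers⇒aligned L  (inj₂ (e , _))        = inj₁ e
  covers⇒aligned LL (inj₁ (_ , e))        = inj₂ e
  covers⇒aligned LL (inj₂ (e , _))        = inj₁ e

  -- `R` is kept apart from the history so that it grows only when Dominator moves.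
  RowsIn : List (Fin m) → List (Fin m × Fin n) → Set
  RowsIn R = All (λ u → proj₁ u ∈ R)

  undominated : ∀ h R → RowsIn R h → length R < m → length h < n →
                ∃[ i ] ∃[ j ] (i ∉ R × Undominated G game h (i , j))
  undominated h R rows |R|< |h|<
    with fresh R |R|< | fresh (map proj₂ h) (subst (_< n) (sym (length-map proj₂ h)) |h|<)
  ... | i , i∉ | j , j∉ = i , j , i∉ , dom
    where
    dom : Undominated G game h (i , j)
    dom any with find any
    ... | u , u∈h , cov with covers⇒aligned game cov
    ...   | inj₁ refl = i∉ (All.lookup rows u∈h)
    ...   | inj₂ refl = j∉ (∈-map⁺ proj₂ u∈h)

  -- The two inequalities reserve a row for each of the `suc k` remaining moves of Dominator and a
  -- column for each of the `suc (k * 2)` remaining moves of either player.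
  dominator-lasts : ∀ k h R → RowsIn R h → length R + suc k ≤ m → length h + suc (k * 2) ≤ n →
                    LastsAtLeast G game Dominator (suc (k * 2)) h
  staller-lasts   : ∀ k v h R → RowsIn R (v ∷ h) → length R + k ≤ m → length (v ∷ h) + k * 2 ≤ n →
                    LastsAtLeast G game Staller (k * 2) (v ∷ h)

  dominator-lasts k h R rows |R|≤ |h|≤
    with undominated h R rows (<-≤-trans (m<m+n (length R) 0<1+n) |R|≤)
                              (<-≤-trans (m<m+n (length h) 0<1+n) |h|≤)
  ... | i , j , _ , x∉ with K□K-isolateFree m n 2≤m (i , j)
  ...   | y , a = (y , neighbour-legal G game x∉ (Graph.Adj-sym G {i , j} {y} a)) , λ v _ →
    staller-lasts k v h (proj₁ v ∷ R) (here refl ∷ All.map there rows)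
      (subst (_≤ m) (+-suc (length R) k) |R|≤)
      (subst (_≤ n) (+-suc (length h) (k * 2)) |h|≤)

  staller-lasts zero    v h R rows |R|≤ |h|≤ = tt
  staller-lasts (suc k) v h R rows@(row ∷ _) |R|≤ |h|≤
    with undominated (v ∷ h) R rows (<-≤-trans (m<m+n (length R) 0<1+n) |R|≤)
                                    (<-≤-trans (m<m+n (suc (length h)) 0<1+n) |h|≤)
  -- Row `proj₁ v` is already in `R` and `i` is not, so this vertex is a neighbour of the
  -- undominated `(i , j)` and `R` need not grow.
  ... | i , j , i∉ , x∉ = (proj₁ v , j) ,
    neighbour-legal G game x∉ (inj₁ ((λ { refl → i∉ row }) , refl)) ,
    dominator-lasts k _ R (row ∷ rows) |R|≤
      (subst (_≤ n) (+-suc (suc (length h)) (suc (k * 2))) |h|≤)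

rook-game : ∀ game k {l n} → l ≡ suc (k * 2) → 2 ≤ suc k → l ≤ n → γ[ game ] (K (suc k) □ K n) ≐ l
-- Matching on `s≤s` makes `n` a successor, so column `zero` exists for Dominator.
rook-game game k refl 2≤m n≥@(s≤s _) =
  rook-ends game k 2≤m zero , dominator-lasts game 2≤m k [] [] [] ≤-refl n≥

proposition5p1 : ∀ (m n : ℕ) → 2 ≤ m → 2 * m ∸ 1 ≤ n →
    (γ[ Z ] (K m □ K n) ≐ (2 * m ∸ 1)) ×
    (γ[ L ] (K m □ K n) ≐ (2 * m ∸ 1)) ×
    (γ[ LL ] (K m □ K n) ≐ (2 * m ∸ 1))
proposition5p1 (suc k) n 2≤m n≥ = play Z , play L , play LL
  where
  play : ∀ game → γ[ game ] (K (suc k) □ K n) ≐ (2 * suc k ∸ 1)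
  -- After commuting, `suc k * 2` computes to `2 + k * 2`, and the subtraction reduces.
  play game = rook-game game k (cong (_∸ 1) (*-comm 2 (suc k))) 2≤m n≥
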